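{- $\alpha(13,2)=3781$. More precisely, there exists an independent set of cardinality $3781$ in the simple graph underlying $B(13,2)$ that contains the word $0^{13}$ and does not contain the word $1^{13}$.
   Context: The de Bruijn digraph $B(k,2)$ has vertex set $\{0,1\}^k$ and edges $x_1\dots x_k\to x_2\dots x_k y$, $y\in\{0,1\}$. In its underlying simple graph (loops deleted), distinct words $x_1\dots x_k$, $y_1\dots y_k$ are adjacent iff $x_2\dots x_k=y_1\dots y_{k-1}$ or $y_2\dots y_k=x_1\dots x_{k-1}$. $\alpha(k,2)$ is the independence number of this simple graph. -}

module Defs where

open import Data.Bool using (Bool; true; false)
open import Data.Nat using (ℕ; suc; _≤_)
open import Data.Vec using (Vec; tail; init; replicate)
open import Data.List using (List; length)
open import Data.List.Membership.Propositional using (_∈_; _∉_)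
open import Data.List.Relation.Unary.Unique.Propositional using (Unique)
open import Data.Product using (_×_; Σ)
open import Data.Sum using (_⊎_)
open import Relation.Binary.PropositionalEquality using (_≡_; _≢_)
open import Relation.Nullary using (¬_)

Word : ℕ → Set
Word k = Vec Bool k

-- Adjacency in the simple graph underlying the de Bruijn digraph B(k,2),
-- for k = suc n ≥ 1: distinct words x, y with x₂…x_k = y₁…y_{k-1}
-- or y₂…y_k = x₁…x_{k-1}.  (Loops are removed by requiring x ≢ y.)
Adj : ∀ {n} → Word (suc n) → Word (suc n) → Set
Adj x y = x ≢ y × (tail x ≡ init y ⊎ tail y ≡ init x)

-- A finite set of vertices, represented as a duplicate-free list
-- (its cardinality is its length), which is independent.
Independent : ∀ {n} → List (Word (suc n)) → Set
Independent S = ∀ {x y} → x ∈ S → y ∈ S → ¬ Adj x y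

IsIndependenceNumber : (n m : ℕ) → Set
IsIndependenceNumber n m =
  Σ (List (Word (suc n))) (λ S → Unique S × Independent S × length S ≡ m)
  × (∀ (S : List (Word (suc n))) → Unique S → Independent S → length S ≤ m)

zeros ones : (k : ℕ) → Word k
zeros k = replicate k false
ones  k = replicate k true

{-# OPTIONS --safe #-}

-- Upper bound: on a rotation orbit of odd length 13 an independent set S meets
-- the 13 consecutive rotations of a non-constant word at most 6 times, and those
-- of a constant word at most 13 times.  Summing over all words (each word is
-- counted 13 times) gives |S| ≤ 3782.  Equality would force every local bound to
-- be attained, so 0¹³, 1¹³ ∈ S.  Going up through the orbits of (01)ʲ0¹³⁻²ʲ, two
-- rotations at even distance are excluded by the words found for j - 1, and
-- since the orbit is met exactly 6 times, the rotations alternate between them.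
-- For j = 6 this yields (01)⁶0 ∈ S, and by symmetry (10)⁶1 ∈ S, but these two
-- words are adjacent.
--
-- Lower bound: for any set G of words of length 12, the words x with
-- x₂…x₁₃ ∈ G and x₁…x₁₂ ∉ G are independent.  With ζ = exp(12πi/13), take
-- G = {w : Im (Σⱼ wⱼ ζʲ) > 0}: rotating x multiplies Σⱼ xⱼ ζʲ by a power of ζ,
-- and x is selected iff this number lies in a half-open sector of angle 12π/13,
-- which meets each non-constant orbit exactly 6 times.  To these 3780 words
-- 0¹³ can be added.

module Submission where

open import Defs
open import Data.Nat using (ℕ)
open import Data.List using (List; length)
open import Data.List.Membership.Propositional using (_∈_; _∉_)
open import Data.List.Relation.Unary.Unique.Propositional using (Unique)
open import Data.Product using (_×_; Σ)
open import Relation.Binary.PropositionalEquality using (_≡_)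

open import Data.Bool using (Bool; true; false; not; if_then_else_)
import Data.Bool.Properties as Bool
open import Data.List using ([]; _∷_; _++_; map; filter)
import Data.List.Membership.DecPropositional as DecMembership
open import Data.List.Membership.Propositional.Properties
  using (∈-map⁻; ∈-filter⁻)
open import Data.List.Relation.Unary.All as All using ()
open import Data.List.Relation.Unary.AllPairs using ([]; _∷_)
open import Data.List.Relation.Unary.Any using (here; there)
open import Data.List.Relation.Unary.Unique.Propositional.Properties
  using (map⁺; ++⁺; filter⁺)
open import Data.Nat using (zero; suc; _+_; _*_; _∸_; _^_; _≤_; _<_; _<?_; z≤n; s≤s)
open import Data.Nat.Properties
open import Algebra.Properties.CommutativeSemigroup +-commutativeSemigroup using (interchange)
open import Data.Nat.Solver using (module +-*-Solver)
open import Data.Empty using (⊥)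
open import Data.Product using (∃; _,_; proj₁; proj₂)
open import Data.Sum using (_⊎_; inj₁; inj₂; swap)
open import Data.Vec using (Vec; []; _∷_; _∷ʳ_; head; tail; init; last; initLast; replicate)
import Data.Vec.Properties as Vec
open import Function using (_∘_)
open import Relation.Binary.PropositionalEquality
  using (_≢_; refl; sym; trans; cong; cong₂; subst; module ≡-Reasoning)
open import Relation.Nullary using (¬_; Dec; yes; no; does; contradiction; from-yes; from-no)
open import Relation.Nullary.Decidable using (_×-dec_; _⊎-dec_; ¬?)

private
  variable
    n : ℕ

-- Decidability of adjacency

_≟ʷ_ : (x y : Word n) → Dec (x ≡ y)
_≟ʷ_ = Vec.≡-dec Bool._≟_

adj? : (x y : Word (suc n)) → Dec (Adj x y)
adj? x y = ¬? (x ≟ʷ y) ×-dec ((tail x ≟ʷ init y) ⊎-dec (tail y ≟ʷ init x))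

-- Sums over all words

sumW : (Word n → ℕ) → ℕ
sumW {zero}  f = f []
sumW {suc n} f = sumW (f ∘ (false ∷_)) + sumW (f ∘ (true ∷_))

sumW-cong : {f g : Word n → ℕ} → (∀ x → f x ≡ g x) → sumW f ≡ sumW g
sumW-cong {zero}  e = e []
sumW-cong {suc n} e = cong₂ _+_ (sumW-cong (e ∘ (false ∷_))) (sumW-cong (e ∘ (true ∷_)))

sumW-mono : {f g : Word n → ℕ} → (∀ x → f x ≤ g x) → sumW f ≤ sumW g
sumW-mono {zero}  e = e []
sumW-mono {suc n} e = +-mono-≤ (sumW-mono (e ∘ (false ∷_))) (sumW-mono (e ∘ (true ∷_)))

sumW-+ : (f g : Word n → ℕ) → sumW (λ x → f x + g x) ≡ sumW f + sumW g
sumW-+ {zero}  f g = refl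
sumW-+ {suc n} f g =
  trans (cong₂ _+_ (sumW-+ (f ∘ (false ∷_)) (g ∘ (false ∷_)))
                   (sumW-+ (f ∘ (true ∷_)) (g ∘ (true ∷_))))
        (interchange (sumW (f ∘ (false ∷_))) (sumW (g ∘ (false ∷_)))
                     (sumW (f ∘ (true ∷_))) (sumW (g ∘ (true ∷_))))

sumW-const : ∀ n c → sumW {n} (λ _ → c) ≡ 2 ^ n * c
sumW-const zero    c = sym (+-identityʳ c)
sumW-const (suc n) c = begin
  sumW {n} (λ _ → c) + sumW {n} (λ _ → c)  ≡⟨ cong₂ _+_ (sumW-const n c) (sumW-const n c) ⟩
  2 ^ n * c + 2 ^ n * c                    ≡⟨ *-distribʳ-+ c (2 ^ n) (2 ^ n) ⟨
  (2 ^ n + 2 ^ n) * c                      ≡⟨ cong (λ m → (2 ^ n + m) * c) (+-identityʳ (2 ^ n)) ⟨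
  2 ^ suc n * c                            ∎
  where open ≡-Reasoning

sumW-*ˡ : ∀ c (f : Word n → ℕ) → sumW (λ x → c * f x) ≡ c * sumW f
sumW-*ˡ {zero}  c f = refl
sumW-*ˡ {suc n} c f =
  trans (cong₂ _+_ (sumW-*ˡ c (f ∘ (false ∷_))) (sumW-*ˡ c (f ∘ (true ∷_))))
        (sym (*-distribˡ-+ c (sumW (f ∘ (false ∷_))) (sumW (f ∘ (true ∷_)))))

-- Words are sorted by their last letter instead of their first. The left side is `sumW (f ∘ rot)`
-- by computation, so this is invariance under rotation.
sumW-∷ʳ : (f : Word (suc n) → ℕ) →
          sumW (λ w → f (w ∷ʳ false)) + sumW (λ w → f (w ∷ʳ true)) ≡ sumW f
sumW-∷ʳ {zero}  f = refl
sumW-∷ʳ {suc n} f =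
  trans (interchange (sumW (λ w → f (false ∷ (w ∷ʳ false)))) (sumW (λ w → f (true ∷ (w ∷ʳ false))))
                     (sumW (λ w → f (false ∷ (w ∷ʳ true)))) (sumW (λ w → f (true ∷ (w ∷ʳ true)))))
        (cong₂ _+_ (sumW-∷ʳ (f ∘ (false ∷_))) (sumW-∷ʳ (f ∘ (true ∷_))))

+-tight : ∀ {a b c d} → a ≤ c → b ≤ d → c + d ≤ a + b → c ≤ a × d ≤ b
+-tight {a} {b} {c} {d} a≤c b≤d le =
    +-cancelʳ-≤ d c a (≤-trans le (+-monoʳ-≤ a b≤d))
  , +-cancelˡ-≤ c d b (≤-trans le (+-monoˡ-≤ b a≤c))

-- Termwise bounds have no slack once their sums have none. This turns equality in the count into
-- equality on every orbit.
sumW-tight : {f g : Word n → ℕ} → (∀ x → f x ≤ g x) → sumW g ≤ sumW f → ∀ x → g x ≤ f x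
sumW-tight {zero}  e le []      = le
sumW-tight {suc n} e le (b ∷ w)
  with f≤ , t≤ ← +-tight (sumW-mono (e ∘ (false ∷_))) (sumW-mono (e ∘ (true ∷_))) le | b
... | false = sumW-tight (e ∘ (false ∷_)) f≤ w
... | true  = sumW-tight (e ∘ (true ∷_)) t≤ w

-- Indicator functions

[_] : ∀ {A : Set} → Dec A → ℕ
[ d ] = if does d then 1 else 0

[]-yes : ∀ {A : Set} (d : Dec A) → A → [ d ] ≡ 1
[]-yes (yes _) _ = refl
[]-yes (no ¬a) a = contradiction a ¬a

[]-no : ∀ {A : Set} (d : Dec A) → ¬ A → [ d ] ≡ 0
[]-no (yes a) ¬a = contradiction a ¬a
[]-no (no _)  _  = refl

[]-cong : ∀ {A B : Set} (d : Dec A) (e : Dec B) → (A → B) → (B → A) → [ d ] ≡ [ e ]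
[]-cong (yes a) e to from = sym ([]-yes e (to a))
[]-cong (no ¬a) e to from = sym ([]-no e (¬a ∘ from))

[]≤1 : ∀ {A : Set} (d : Dec A) → [ d ] ≤ 1
[]≤1 (yes _) = ≤-refl
[]≤1 (no _)  = z≤n

-- The test compares `x` with `y` in the order used by `∈?`, so that one case split evaluates both
-- `δ a x` and `χ (a ∷ S) x`.
δ : Word n → Word n → ℕ
δ y x = [ x ≟ʷ y ]

sumW-zero : {f : Word n → ℕ} → (∀ x → f x ≡ 0) → sumW f ≡ 0
sumW-zero {n} e = trans (sumW-cong e) (trans (sumW-const n 0) (*-zeroʳ (2 ^ n)))

δ-∷ : ∀ b (y x : Word n) → δ (b ∷ y) (b ∷ x) ≡ δ y x
δ-∷ b y x = []-cong ((b ∷ x) ≟ʷ (b ∷ y)) (x ≟ʷ y) (cong tail) (cong (b ∷_))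

sumW-δ : (y : Word n) → sumW (δ y) ≡ 1
sumW-δ []          = refl
sumW-δ (false ∷ y) = cong₂ _+_ (trans (sumW-cong (δ-∷ false y)) (sumW-δ y))
  (sumW-zero λ x → []-no ((true ∷ x) ≟ʷ (false ∷ y)) λ ())
sumW-δ (true ∷ y)  = cong₂ _+_
  (sumW-zero λ x → []-no ((false ∷ x) ≟ʷ (true ∷ y)) λ ())
  (trans (sumW-cong (δ-∷ true y)) (sumW-δ y))

sumW-peaks : ∀ c d (y z : Word n) →
             sumW (λ x → c + (d * δ y x + d * δ z x)) ≡ 2 ^ n * c + (d + d)
sumW-peaks {n} c d y z = begin
  sumW (λ x → c + (d * δ y x + d * δ z x))
    ≡⟨ sumW-+ (λ _ → c) (λ x → d * δ y x + d * δ z x) ⟩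
  sumW {n} (λ _ → c) + sumW (λ x → d * δ y x + d * δ z x)
    ≡⟨ cong₂ _+_ (sumW-const n c) (sumW-+ (λ x → d * δ y x) (λ x → d * δ z x)) ⟩
  2 ^ n * c + (sumW (λ x → d * δ y x) + sumW (λ x → d * δ z x))
    ≡⟨ cong (2 ^ n * c +_) (cong₂ _+_ (peak y) (peak z)) ⟩
  2 ^ n * c + (d + d) ∎
  where
  open ≡-Reasoning
  peak : ∀ y → sumW (λ x → d * δ y x) ≡ d
  peak y = trans (sumW-*ˡ d (δ y)) (trans (cong (d *_) (sumW-δ y)) (*-identityʳ d))

χ : List (Word n) → Word n → ℕ
χ S x = [ x ∈? S ]
  where open DecMembership _≟ʷ_ using (_∈?_)

length≤sumW-χ : (S : List (Word n)) → Unique S → length S ≤ sumW (χ S)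
length≤sumW-χ []      _              = z≤n
length≤sumW-χ (a ∷ S) (a≢S ∷ S-uniq) = begin
  1 + length S                  ≤⟨ +-monoʳ-≤ 1 (length≤sumW-χ S S-uniq) ⟩
  1 + sumW (χ S)                ≡⟨ cong (_+ sumW (χ S)) (sumW-δ a) ⟨
  sumW (δ a) + sumW (χ S)       ≡⟨ sumW-+ (δ a) (χ S) ⟨
  sumW (λ x → δ a x + χ S x)    ≤⟨ sumW-mono δ+χ≤χ ⟩
  sumW (χ (a ∷ S))              ∎
  where
  open ≤-Reasoning
  open DecMembership _≟ʷ_ using (_∈?_)
  δ+χ≤χ : ∀ x → δ a x + χ S x ≤ χ (a ∷ S) x
  δ+χ≤χ x with x ≟ʷ a
  ... | yes refl = ≤-reflexive (cong suc ([]-no (x ∈? S) λ x∈S → All.lookup a≢S x∈S refl))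
  ... | no _     = ≤-refl

-- Rotations

rot : Word (suc n) → Word (suc n)
rot (b ∷ w) = w ∷ʳ b

rot^ : ℕ → Word (suc n) → Word (suc n)
rot^ zero    x = x
rot^ (suc m) x = rot^ m (rot x)

rot^-+ : ∀ m k (x : Word (suc n)) → rot^ (m + k) x ≡ rot^ k (rot^ m x)
rot^-+ zero    k x = refl
rot^-+ (suc m) k x = rot^-+ m k (rot x)

rot^-13 : (x : Word 13) → rot^ 13 x ≡ x
rot^-13 (_ ∷ _ ∷ _ ∷ _ ∷ _ ∷ _ ∷ _ ∷ _ ∷ _ ∷ _ ∷ _ ∷ _ ∷ _ ∷ []) = refl

-- Only the constant words are excluded, by `rot-fixed`; this is what makes a word adjacent to its
-- rotation.
Aperiodic : Word (suc n) → Set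
Aperiodic x = rot x ≢ x

rot-injective : {x y : Word (suc n)} → rot x ≡ rot y → x ≡ y
rot-injective {x = a ∷ v} {b ∷ w} e with Vec.∷ʳ-injective v w e
... | refl , refl = refl

rot^-aperiodic : ∀ m {x : Word (suc n)} → Aperiodic x → Aperiodic (rot^ m x)
rot^-aperiodic zero    ap = ap
rot^-aperiodic (suc m) ap = rot^-aperiodic m (ap ∘ rot-injective)

∷ʳ≡∷⇒replicate : ∀ b (w : Word n) → w ∷ʳ b ≡ b ∷ w → w ≡ replicate n b
∷ʳ≡∷⇒replicate b []      _ = refl
∷ʳ≡∷⇒replicate b (c ∷ w) e with refl , e′ ← Vec.∷-injective e = cong (b ∷_) (∷ʳ≡∷⇒replicate b w e′)

rot-fixed : (x : Word (suc n)) → rot x ≡ x → x ≡ replicate (suc n) (head x)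
rot-fixed (b ∷ w) e = cong (b ∷_) (∷ʳ≡∷⇒replicate b w e)

rot-adj : {x : Word (suc n)} → Aperiodic x → Adj x (rot x)
rot-adj {x = b ∷ w} ap = ap ∘ sym , inj₁ (sym (Vec.init-∷ʳ b w))

sumW-rot : (f : Word (suc n) → ℕ) → sumW (f ∘ rot) ≡ sumW f
sumW-rot = sumW-∷ʳ

-- Sums over consecutive rotations

orb : (Word (suc n) → ℕ) → ℕ → Word (suc n) → ℕ
orb f zero    x = 0
orb f (suc m) x = f x + orb f m (rot x)

-- Double counting: rotation permutes the words, so each of the `m` terms contributes `sumW f`.
sumW-orb : ∀ (f : Word (suc n) → ℕ) m → sumW (orb f m) ≡ m * sumW f
sumW-orb {n} f zero    = sumW-zero {suc n} λ _ → refl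
sumW-orb f (suc m) =
  trans (sumW-+ f (orb f m ∘ rot))
        (cong (sumW f +_) (trans (sumW-rot (orb f m)) (sumW-orb f m)))

orb-+ : ∀ (f : Word (suc n) → ℕ) m k x → orb f (m + k) x ≡ orb f m x + orb f k (rot^ m x)
orb-+ f zero    k x = refl
orb-+ f (suc m) k x = trans (cong (f x +_) (orb-+ f m k (rot x)))
                            (sym (+-assoc (f x) (orb f m (rot x)) (orb f k (rot^ (suc m) x))))

orb-replicate : ∀ (f : Word (suc n) → ℕ) m {x} → rot x ≡ x → orb f m x ≡ m * f x
orb-replicate f zero    e = refl
orb-replicate f (suc m) {x} e =
  cong (f x +_) (trans (cong (orb f m) e) (orb-replicate f m e))

-- With 1 standing for c and 0 for not c, comb c j is 0¹²⁻²ʲ 1 (01)ʲ.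
comb : Bool → ℕ → Word 13
comb c zero    = replicate 12 (not c) ∷ʳ c
comb c (suc j) = tail (tail (comb c j) ∷ʳ not c) ∷ʳ c

comb-aperiodic : ∀ c {j} → j ≤ 5 → Aperiodic (comb c j)
comb-aperiodic c = below-6 c ∘ s≤s
  where
  aperiodic? : ∀ c → Dec (∀ {j} → j < 6 → Aperiodic (comb c j))
  aperiodic? c = allUpTo? (λ j → ¬? (rot (comb c j) ≟ʷ comb c j)) 6
  below-6 : ∀ c {j} → j < 6 → Aperiodic (comb c j)
  -- The decision procedure evaluates only for a concrete letter.
  below-6 false = from-yes (aperiodic? false)
  below-6 true  = from-yes (aperiodic? true)

comb-base : ∀ c → Adj (replicate 13 (not c)) (comb c 0)
                × Adj (replicate 13 (not c)) (rot^ 12 (comb c 0))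
comb-base = λ { false → from-yes (base? false) ; true → from-yes (base? true) }
  where
  base? : ∀ c → Dec (Adj (replicate 13 (not c)) (comb c 0)
                   × Adj (replicate 13 (not c)) (rot^ 12 (comb c 0)))
  base? c = adj? (replicate 13 (not c)) (comb c 0)
      ×-dec adj? (replicate 13 (not c)) (rot^ 12 (comb c 0))

-- For `c = true`, the words found at stage `j` are 0¹¹⁻²ʲ1(01)ʲ0 and (01)ʲ⁺¹0¹¹⁻²ʲ. They exclude
-- 0¹⁰⁻²ʲ1(01)ʲ⁺¹ and 1(01)ʲ⁺¹0¹⁰⁻²ʲ from the next orbit.
CombStep : Bool → ℕ → Set
CombStep c j = Adj (rot (comb c j)) (comb c (suc j))
             × Adj (rot^ (1 + (5 ∸ j) * 2) (comb c j)) (rot^ (2 + (5 ∸ suc j) * 2) (comb c (suc j)))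

comb-step : ∀ c {j} → j < 5 → CombStep c j
comb-step = λ { false → from-yes (step? false) ; true → from-yes (step? true) }
  where
  step? : ∀ c → Dec (∀ {j} → j < 5 → CombStep c j)
  step? c = allUpTo? (λ j → adj? _ _ ×-dec adj? _ _) 5

-- These are (10)⁶1 and (01)⁶0, where the climbs from 1¹³ and from 0¹³ end.
combs-adjacent : Adj (rot (comb false 5)) (rot (comb true 5))
combs-adjacent = from-yes (adj? (rot (comb false 5)) (rot (comb true 5)))

-- Local bounds on the rotation orbits

module Packing
  (f : Word 13 → ℕ)
  (f≤1 : ∀ x → f x ≤ 1)
  (f-adj : ∀ {x y} → Adj x y → f x + f y ≤ 1)
  where

  T : Word 13 → ℕ
  T = orb f 13

  -- The local bound for `T`: 6 on non-constant words and 6 + 7 = 13 on the two constant ones.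
  u : Word 13 → ℕ
  u x = 6 + (7 * δ (zeros 13) x + 7 * δ (ones 13) x)

  -- The rotations are taken in `m` consecutive pairs, each of adjacent words.
  orb-even : ∀ m {x} → Aperiodic x → orb f (m * 2) x ≤ m
  orb-even zero    ap = z≤n
  orb-even (suc m) {x} ap = begin
    f x + (f (rot x) + orb f (m * 2) (rot^ 2 x))  ≡⟨ +-assoc (f x) (f (rot x)) _ ⟨
    f x + f (rot x) + orb f (m * 2) (rot^ 2 x)    ≤⟨ +-mono-≤ (f-adj (rot-adj ap)) (orb-even m (rot^-aperiodic 2 ap)) ⟩
    suc m                                         ∎
    where open ≤-Reasoning

  T-rot : ∀ x → T (rot x) ≡ T x
  T-rot x = begin
    T (rot x)                             ≡⟨ orb-+ f 12 1 (rot x) ⟩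
    orb f 12 (rot x) + (f (rot^ 13 x) + 0) ≡⟨ cong (orb f 12 (rot x) +_) (+-identityʳ (f (rot^ 13 x))) ⟩
    orb f 12 (rot x) + f (rot^ 13 x)      ≡⟨ cong (λ y → orb f 12 (rot x) + f y) (rot^-13 x) ⟩
    orb f 12 (rot x) + f x                ≡⟨ +-comm (orb f 12 (rot x)) (f x) ⟩
    T x                                   ∎
    where open ≡-Reasoning

  f-cases : ∀ x → f x ≡ 0 ⊎ f x ≡ 1
  f-cases x with f x | f≤1 x
  ... | 0 | _ = inj₁ refl
  ... | 1 | _ = inj₂ refl
  ... | suc (suc _) | s≤s ()

  adj-zero : ∀ {x y} → Adj x y → f x ≡ 1 → f y ≡ 0
  adj-zero {x} {y} a e = n≤0⇒n≡0 (+-cancelˡ-≤ 1 (f y) 0 (subst (λ m → m + f y ≤ 1) e (f-adj a)))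

  T≤6-at-zero : ∀ {x} → Aperiodic x → f x ≡ 0 → T x ≤ 6
  T≤6-at-zero {x} ap e = begin
    f x + orb f 12 (rot x)  ≡⟨ cong (_+ orb f 12 (rot x)) e ⟩
    orb f 12 (rot x)        ≤⟨ orb-even 6 (rot^-aperiodic 1 ap) ⟩
    6                       ∎
    where open ≤-Reasoning

  -- One of `x` and `rot x` has value 0. Starting the orbit there leaves 12 rotations, hence 6
  -- pairs.
  T≤6 : ∀ {x} → Aperiodic x → T x ≤ 6
  T≤6 {x} ap with f-cases x
  ... | inj₁ e = T≤6-at-zero ap e
  ... | inj₂ e = subst (_≤ 6) (T-rot x)
                   (T≤6-at-zero (rot^-aperiodic 1 ap) (adj-zero (rot-adj ap) e))

  T-replicate≤13 : ∀ b → T (replicate 13 b) ≤ 13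
  T-replicate≤13 b = ≤-trans (≤-reflexive (orb-replicate f 13 {replicate 13 b} refl))
                             (*-monoʳ-≤ 13 (f≤1 (replicate 13 b)))

  T≤u : ∀ x → T x ≤ u x
  T≤u x with rot x ≟ʷ x
  ... | no ap = ≤-trans (T≤6 ap) (m≤m+n 6 _)
  ... | yes e with head x | rot-fixed x e
  ...   | false | refl = T-replicate≤13 false
  ...   | true  | refl = T-replicate≤13 true

  -- The three zeros split the rest of the orbit into two paths of even length.
  T≤5 : ∀ k l → k + l ≡ 5 → ∀ {y} → Aperiodic y →
        f y ≡ 0 → f (rot y) ≡ 0 → f (rot^ (2 + k * 2) y) ≡ 0 → T y ≤ 5
  T≤5 k l k+l≡5 {y} ap e₀ e₁ e₂ = begin
    T y
      ≡⟨ cong (λ m → orb f m y) (trans (cong (λ m → m * 2 + 3) (sym k+l≡5)) (rearrange k l)) ⟩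
    orb f ((2 + k * 2) + (1 + l * 2)) y
      ≡⟨ orb-+ f (2 + k * 2) (1 + l * 2) y ⟩
    f y + (f (rot y) + orb f (k * 2) (rot^ 2 y)) + (f z + orb f (l * 2) (rot z))
      ≡⟨ cong₂ _+_ (cong₂ (λ a b → a + (b + orb f (k * 2) (rot^ 2 y))) e₀ e₁)
                   (cong (_+ orb f (l * 2) (rot z)) e₂) ⟩
    orb f (k * 2) (rot^ 2 y) + orb f (l * 2) (rot z)
      ≤⟨ +-mono-≤ (orb-even k (rot^-aperiodic 2 ap)) (orb-even l (rot^-aperiodic 1 (rot^-aperiodic (2 + k * 2) ap))) ⟩
    k + l
      ≡⟨ k+l≡5 ⟩
    5 ∎
    where
    open ≤-Reasoning
    z = rot^ (2 + k * 2) y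
    rearrange : ∀ k l → (k + l) * 2 + 3 ≡ (2 + k * 2) + (1 + l * 2)
    rearrange = solve 2 (λ k l → (k :+ l) :* con 2 :+ con 3
                             := (con 2 :+ k :* con 2) :+ (con 1 :+ l :* con 2)) refl
      where open +-*-Solver

  u≤T : 3782 ≤ sumW f → ∀ x → u x ≤ T x
  u≤T 3782≤ = sumW-tight T≤u (begin
    -- 6 · 2¹³ + 2 · 7 = 49166 = 13 · 3782, so the summed local bounds leave no slack.
    sumW u         ≡⟨ sumW-peaks 6 7 (zeros 13) (ones 13) ⟩
    13 * 3782      ≤⟨ *-monoʳ-≤ 13 3782≤ ⟩
    13 * sumW f    ≡⟨ sumW-orb f 13 ⟨
    sumW T         ∎)
    where open ≤-Reasoning

  -- The case of equality

  module Tight (u≤T : ∀ x → u x ≤ T x) where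

    constant∈ : ∀ b → f (replicate 13 b) ≡ 1
    constant∈ b = ≤-antisym (f≤1 (replicate 13 b)) (*-cancelˡ-≤ 13 (begin
      13                      ≡⟨ u-constant b ⟩
      u (replicate 13 b)      ≤⟨ u≤T (replicate 13 b) ⟩
      T (replicate 13 b)      ≡⟨ orb-replicate f 13 {replicate 13 b} refl ⟩
      13 * f (replicate 13 b) ∎))
      where
      open ≤-Reasoning
      u-constant : ∀ b → 13 ≡ u (replicate 13 b)
      u-constant false = refl
      u-constant true  = refl

    -- The three zeros would bring the orbit down to 5, while `u` demands at least 6.
    ¬all-zero : ∀ k l → k + l ≡ 5 → ∀ {y} → Aperiodic y →
                f y ≡ 0 → f (rot y) ≡ 0 → f (rot^ (2 + k * 2) y) ≢ 0
    ¬all-zero k l k+l≡5 {y} ap e₀ e₁ e₂ =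
      <⇒≱ (s≤s (T≤5 k l k+l≡5 ap e₀ e₁ e₂)) (≤-trans (m≤m+n 6 _) (u≤T y))

    -- A further zero right after the first given one, or right before the second, would make two
    -- consecutive zeros and a third one as in `¬all-zero`.
    between-zeros : ∀ k l → k + l ≡ 5 → ∀ {x} → Aperiodic x →
                    f x ≡ 0 → f (rot^ (2 + k * 2) x) ≡ 0 →
                    f (rot x) ≡ 1 × f (rot^ (1 + k * 2) x) ≡ 1
    between-zeros k l k+l≡5 {x} ap e₀ e₂ =
        nonzero (λ e₁ → ¬all-zero k l k+l≡5 ap e₀ e₁ e₂)
      -- The orbit is now read from `y`, just before the second zero. Going on around it, the third
      -- zero is `x` itself, so `k` and `l` change places.
      , nonzero (λ e₁ → ¬all-zero l k (trans (+-comm l k) k+l≡5)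
                          (rot^-aperiodic (1 + k * 2) ap)
                          e₁ (trans (cong f (sym rot-y)) e₂) (trans (cong f back-to-x) e₀))
      where
      y = rot^ (1 + k * 2) x

      nonzero : ∀ {x} → f x ≢ 0 → f x ≡ 1
      nonzero {x} ≢0 = ≤-antisym (f≤1 x) (n≢0⇒n>0 ≢0)

      rot-y : rot^ (2 + k * 2) x ≡ rot y
      rot-y = trans (cong (λ m → rot^ m x) (+-comm 1 (1 + k * 2))) (rot^-+ (1 + k * 2) 1 x)

      back-to-x : rot^ (2 + l * 2) y ≡ x
      back-to-x = begin
        rot^ (2 + l * 2) y                  ≡⟨ rot^-+ (1 + k * 2) (2 + l * 2) x ⟨
        rot^ ((1 + k * 2) + (2 + l * 2)) x  ≡⟨ cong (λ m → rot^ m x) (rearrange k l) ⟩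
        rot^ ((k + l) * 2 + 3) x            ≡⟨ cong (λ m → rot^ (m * 2 + 3) x) k+l≡5 ⟩
        rot^ 13 x                           ≡⟨ rot^-13 x ⟩
        x                                   ∎
        where
        open ≡-Reasoning
        open +-*-Solver
        rearrange : ∀ k l → (1 + k * 2) + (2 + l * 2) ≡ (k + l) * 2 + 3
        rearrange = solve 2 (λ k l → (con 1 :+ k :* con 2) :+ (con 2 :+ l :* con 2)
                                 := (k :+ l) :* con 2 :+ con 3) refl

    comb∈ : ∀ c j → j ≤ 5 → f (rot (comb c j)) ≡ 1 × f (rot^ (1 + (5 ∸ j) * 2) (comb c j)) ≡ 1
    comb∈ c zero    j≤5 =
      -- The neighbours 0¹²1 and 10¹² of 0¹³ (or their complements) are 12 = 2 + 5 · 2 rotations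
      -- apart.
      between-zeros 5 0 refl (comb-aperiodic c j≤5)
        (adj-zero (proj₁ (comb-base c)) (constant∈ (not c)))
        (adj-zero (proj₂ (comb-base c)) (constant∈ (not c)))
    comb∈ c (suc j) j<5 with e₁ , e₂ ← comb∈ c j (<⇒≤ j<5) =
      between-zeros (5 ∸ suc j) (suc j) (m∸n+n≡m j<5) (comb-aperiodic c j<5)
        (adj-zero (proj₁ (comb-step c j<5)) e₁)
        (adj-zero (proj₂ (comb-step c j<5)) e₂)

    absurd : ⊥
    absurd = 0≢1+n (trans (sym (adj-zero combs-adjacent (proj₁ (comb∈ false 5 ≤-refl))))
                          (proj₁ (comb∈ true 5 ≤-refl)))

-- The upper bound for independent sets

indicator-adj : {S : List (Word (suc n))} → Independent S → ∀ {x y} → Adj x y → χ S x + χ S y ≤ 1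
indicator-adj {S = S} ind {x} {y} a = by-cases (x ∈? S) (y ∈? S)
  where
  open DecMembership _≟ʷ_ using (_∈?_)
  by-cases : (d : Dec (x ∈ S)) (e : Dec (y ∈ S)) → [ d ] + [ e ] ≤ 1
  by-cases (yes x∈S) (yes y∈S) = contradiction a (ind x∈S y∈S)
  by-cases (yes _)   (no _)    = ≤-refl
  by-cases (no _)    e         = []≤1 e

upper-bound : (S : List (Word 13)) → Unique S → Independent S → length S ≤ 3781
upper-bound S uniq ind = ≮⇒≥ λ 3781< →
  Tight.absurd (u≤T (≤-trans 3781< (length≤sumW-χ S uniq)))
  where
  open DecMembership _≟ʷ_ using (_∈?_)
  open Packing (χ S) (λ x → []≤1 (x ∈? S)) (indicator-adj ind)

-- The independent set

allWords : ∀ n → List (Word n)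
allWords zero    = [] ∷ []
allWords (suc n) = map (false ∷_) (allWords n) ++ map (true ∷_) (allWords n)

allWords-unique : ∀ n → Unique (allWords n)
allWords-unique zero    = All.[] ∷ []
allWords-unique (suc n) =
  ++⁺ (map⁺ Vec.∷-injectiveʳ (allWords-unique n)) (map⁺ Vec.∷-injectiveʳ (allWords-unique n))
      λ (p , q) → heads-differ (∈-map⁻ (false ∷_) p) (∈-map⁻ (true ∷_) q)
  where
  heads-differ : ∀ {x : Word (suc n)} → (∃ λ v → v ∈ allWords n × x ≡ false ∷ v) →
                 ¬ (∃ λ w → w ∈ allWords n × x ≡ true ∷ w)
  heads-differ (_ , _ , refl) (_ , _ , ())

weigh : Vec ℕ n → Word n → ℕ
weigh []       []          = 0
weigh (_ ∷ cs) (false ∷ w) = weigh cs w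
weigh (c ∷ cs) (true ∷ w)  = c + weigh cs w

-- The coefficients are 29 sin (12πj/13) for j = 1, …, 12, rounded, and split
-- into their negative and positive parts.
c⁻ c⁺ : Vec ℕ 12
c⁻ = 0 ∷ 13 ∷ 0 ∷ 24 ∷ 0 ∷ 29 ∷ 0 ∷ 27 ∷ 0 ∷ 19 ∷ 0 ∷ 7 ∷ []
c⁺ = 7 ∷ 0 ∷ 19 ∷ 0 ∷ 27 ∷ 0 ∷ 29 ∷ 0 ∷ 24 ∷ 0 ∷ 13 ∷ 0 ∷ []

Up : Word 12 → Set
Up w = weigh c⁻ w < weigh c⁺ w

up? : ∀ w → Dec (Up w)
up? w = weigh c⁻ w <? weigh c⁺ w

-- Up to the rounding of the sines, and with z = Σⱼ xⱼζʲ for j = 1, ..., 13, this says Im z ≤ 0 < Im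
-- (ζ⁻¹z): the letter dropped on either side has a real coefficient there.
Selected : Word 13 → Set
Selected x = Up (tail x) × ¬ Up (init x)

selected? : ∀ x → Dec (Selected x)
selected? x = up? (tail x) ×-dec ¬? (up? (init x))

selected : List (Word 13)
selected = filter selected? (allWords 13)

-- The 12 letters shared by adjacent words would form a word both inside and outside `Up`.
selected-nonadjacent : ∀ {x y} → Selected x → Selected y → ¬ Adj x y
selected-nonadjacent (up-x , _) (_ , ¬up-y) (_ , inj₁ e) = ¬up-y (subst Up e up-x)
selected-nonadjacent (_ , ¬up-x) (up-y , _) (_ , inj₂ e) = ¬up-x (subst Up e up-y)

adj-sym : {x y : Word (suc n)} → Adj x y → Adj y x
adj-sym (x≢y , e) = x≢y ∘ sym , swap e

-- A neighbour of 0¹³ has tail 0¹² or 0¹¹1. Their weights are 0 and -7, the last coefficient, so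
-- neither tail is in `Up`.
zeros-nonadjacent : ∀ {y} → Selected y → ¬ Adj (zeros 13) y
zeros-nonadjacent {y} (up-y , _) (_ , inj₁ e) = ¬up (last y) (subst (Up ∘ tail) y≡ up-y)
  where
  y≡ : y ≡ zeros 12 ∷ʳ last y
  y≡ = trans (proj₂ (proj₂ (initLast y))) (cong (_∷ʳ last y) (sym e))
  ¬up : ∀ b → ¬ Up (zeros 11 ∷ʳ b)
  ¬up false = from-no (up? (zeros 11 ∷ʳ false))
  ¬up true  = from-no (up? (zeros 11 ∷ʳ true))
zeros-nonadjacent (up-y , _) (_ , inj₂ e) = from-no (up? (zeros 12)) (subst Up e up-y)

solution : List (Word 13)
solution = zeros 13 ∷ selected

∈selected⇒Selected : ∀ {x} → x ∈ selected → Selected x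
∈selected⇒Selected = proj₂ ∘ ∈-filter⁻ selected? {xs = allWords 13}

solution-unique : Unique solution
solution-unique = All.tabulate zeros≢ ∷ filter⁺ selected? (allWords-unique 13)
  where
  zeros≢ : ∀ {x} → x ∈ selected → zeros 13 ≢ x
  zeros≢ x∈ refl = from-no (selected? (zeros 13)) (∈selected⇒Selected x∈)

solution-independent : Independent solution
solution-independent (here refl) (here refl) (0≢0 , _) = 0≢0 refl
solution-independent (here refl) (there y∈) = zeros-nonadjacent (∈selected⇒Selected y∈)
solution-independent (there x∈) (here refl) = zeros-nonadjacent (∈selected⇒Selected x∈) ∘ adj-sym
solution-independent (there x∈) (there y∈) =
  selected-nonadjacent (∈selected⇒Selected x∈) (∈selected⇒Selected y∈)

-- Evaluating `selected?` on all 2¹³ words gives the count, so no estimate of the rounding errors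
-- enters.
solution-length : length solution ≡ 3781
solution-length = refl

ones∉solution : ones 13 ∉ solution
ones∉solution (here ())
-- The entries of `c⁻` and of `c⁺` both sum to 119, so 1¹² is not in `Up`.
ones∉solution (there p) = from-no (selected? (ones 13)) (∈selected⇒Selected p)

theorem4p9 : IsIndependenceNumber 12 3781
    × Σ (List (Word 13)) (λ S → Unique S × Independent S × length S ≡ 3781
    × zeros 13 ∈ S × ones 13 ∉ S)
theorem4p9 =
    ((solution , solution-unique , solution-independent , solution-length) , upper-bound)
  , (solution , solution-unique , solution-independent , solution-length , here refl , ones∉solution)
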